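{- Let $G$ be an $\mathrm{AT}$-free graph with vertex set $V$, and let $\mathcal{C}$ be the collection of convex sets of $G$. Then $(V,\mathcal{C})$ is a convex geometry.
   Context: Graphs are finite and simple. For a vertex $x$, $N(x)$ is its neighborhood and $N[x]=N(x)\cup\{x\}$. An asteroidal triple is a set of three vertices such that every pair of them is connected by a path avoiding the closed neighborhood of the third; a graph is $\mathrm{AT}$-free if it has no asteroidal triple. For vertices $x,y$, a vertex $z$ is between $x$ and $y$ if there is a path from $z$ to $x$ all of whose vertices avoid $N[y]$ and a path from $z$ to $y$ all of whose vertices avoid $N[x]$; $I(x,y)$ denotes the set of vertices between $x$ and $y$. A set $W\subseteq V$ is convex if for all $u,w\in W$ we have $I(u,w)\subseteq W$. For $U\subseteq V$ let $\sigma(U)$ be the intersection of all convex sets containing $U$. A convex geometry on $V$ is a collection $\mathcal{C}$ of subsets of $V$ such that $V,\varnothing\in\mathcal{C}$, $\mathcal{C}$ is closed under intersections, and the anti-exchange property holds: for every $Y\in\mathcal{C}$ and distinct $x,z\notin Y$, if $z\in\sigma(Y\cup\{x\})$ then $x\notin\sigma(Y\cup\{z\})$. -}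

module Defs where

open import Data.Nat using (ℕ)
open import Data.Bool using (Bool; true; false)
open import Data.Fin using (Fin)
open import Data.Fin.Subset using (Subset; _∈_; _∉_; _∪_; _∩_; _⊆_; ⁅_⁆; ⊤; ⊥)
open import Data.Product using (_×_)
open import Relation.Nullary using (¬_)
open import Relation.Binary.PropositionalEquality using (_≡_; _≢_)
open import Data.Sum using (_⊎_)

record Graph (n : ℕ) : Set where
  field
    adj     : Fin n → Fin n → Bool
    symm    : ∀ u v → adj u v ≡ adj v u
    irrefl  : ∀ v → adj v v ≡ false

module _ {n : ℕ} (G : Graph n) where
  open Graph G

  InClosedNbhd : Fin n → Fin n → Set
  InClosedNbhd x v = (v ≡ x) ⊎ (adj x v ≡ true)

  -- walk from a to b all of whose vertices avoid N[c]
  -- (existence of such a walk ⇔ existence of such a path)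
  data WalkAvoiding (c : Fin n) : Fin n → Fin n → Set where
    here : ∀ {a} → ¬ InClosedNbhd c a → WalkAvoiding c a a
    step : ∀ {a b d} → ¬ InClosedNbhd c a → adj a b ≡ true →
           WalkAvoiding c b d → WalkAvoiding c a d

  Asteroidal : Fin n → Fin n → Fin n → Set
  Asteroidal a b c =
    a ≢ b × a ≢ c × b ≢ c ×
    WalkAvoiding c a b × WalkAvoiding b a c × WalkAvoiding a b c

  ATFree : Set
  ATFree = ∀ a b c → ¬ Asteroidal a b c

  Between : Fin n → Fin n → Fin n → Set
  Between x y z = WalkAvoiding y z x × WalkAvoiding x z y

  Convex : Subset n → Set
  Convex W = ∀ u w → u ∈ W → w ∈ W → ∀ z → Between u w z → z ∈ W

InHull : {n : ℕ} → (Subset n → Set) → Subset n → Fin n → Set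
InHull 𝒞 U x = ∀ W → 𝒞 W → U ⊆ W → x ∈ W

-- convex geometry on V = Fin n (V finite, so closure under intersections
-- is closure under binary intersections together with V ∈ 𝒞)
record ConvexGeometry {n : ℕ} (𝒞 : Subset n → Set) : Set where
  field
    full  : 𝒞 ⊤
    empty : 𝒞 ⊥
    inter : ∀ A B → 𝒞 A → 𝒞 B → 𝒞 (A ∩ B)
    antiExchange : ∀ Y → 𝒞 Y → ∀ x z → x ≢ z → x ∉ Y → z ∉ Y →
                   InHull 𝒞 (Y ∪ ⁅ x ⁆) z → ¬ InHull 𝒞 (Y ∪ ⁅ z ⁆) x

{-# OPTIONS --safe #-}

-- Fix a convex set Y and draw an arrow p ⟶ z when z ∉ Y lies between p and some
-- y ∈ Y.  A vertex p ∉ Y without arrows into the complement of Y can be added to Y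
-- keeping it convex, so anti-exchange follows by induction on the complement
-- once ⟶ is shown to be acyclic.
--
-- Write C_a(b) for the component of b in G − N[a].  In a shortest cycle take
-- consecutive arrows p ⟶ z (via y) and z ⟶ w (via y′).  If p and y′ lie in
-- different components of G − N[z], then C_z(y′) ⊊ C_p(y).  Otherwise the walk
-- turns around at z, and y is left behind for good: it stays separated from the
-- current vertex by the neighbourhood of the current target, and vice versa.
-- At the next turn, the vertex t left behind before is replaced by one with a
-- strictly smaller component.  So the pair (C_t(p), C_p(y)) decreases
-- lexicographically along the cycle, which is absurd.

module Submission where

open import Defs
open import Data.Nat using (ℕ; zero; suc)
open import Data.Bool using (true; false)
import Data.Bool.Properties as Bool
open import Data.Empty using () renaming (⊥ to Empty; ⊥-elim to Empty-elim)
open import Data.Fin using (Fin; _≟_; combine; remQuot)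
open import Data.Fin.Induction using (spo-wellFounded; spo-noetherian)
open import Data.Fin.Properties using (remQuot-combine)
open import Data.Fin.Subset using (Subset; _∈_; _∉_; _∪_; _⊆_; _⊃_; ⁅_⁆)
open import Data.Fin.Subset.Induction using (⊃-wellFounded)
open import Data.Fin.Subset.Properties
open import Data.Product using (_×_; _,_; ∃-syntax; proj₁; proj₂; swap; uncurry)
open import Data.Sum using (_⊎_; inj₁; inj₂; [_,_]′)
open import Data.Unit using (⊤)
open import Function using (_∘_; _on_)
open import Induction.WellFounded using (WellFounded; Acc; acc; module Subrelation)
open import Relation.Binary using (Rel)
import Relation.Binary.Construct.On as On
open import Relation.Binary.PropositionalEquality
open import Relation.Nullary using (¬_; Dec; yes; no)
open import Relation.Nullary.Decidable using (_⊎-dec_)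

-- Walks avoiding closed neighbourhoods

module _ {n : ℕ} (G : Graph n) where
  open Graph G

  private
    V : Set
    V = Fin n

    N : V → V → Set
    N = InClosedNbhd G

    W : V → V → V → Set
    W = WalkAvoiding G

  N? : ∀ c a → Dec (N c a)
  N? c a = (a ≟ c) ⊎-dec (adj c a Bool.≟ true)

  N-refl : ∀ {a} → N a a
  N-refl = inj₁ refl

  N-sym : ∀ {a b} → N a b → N b a
  N-sym (inj₁ eq) = inj₁ (sym eq)
  N-sym (inj₂ e)  = inj₂ (trans (symm _ _) e)

  walk-start : ∀ {c a b} → W c a b → ¬ N c a
  walk-start (here ca)     = ca
  walk-start (step ca _ _) = ca

  walk-trans : ∀ {c a b d} → W c a b → W c b d → W c a d
  walk-trans (here _)      q = q
  walk-trans (step ca e p) q = step ca e (walk-trans p q)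

  walk-sym : ∀ {c a b} → W c a b → W c b a
  walk-sym (here ca)     = here ca
  walk-sym (step ca e p) =
    walk-trans (walk-sym p) (step (walk-start p) (trans (symm _ _) e) (here ca))

  walk-end : ∀ {c a b} → W c a b → ¬ N c b
  walk-end = walk-start ∘ walk-sym

  nbhd-walk : ∀ {c a b} → N a b → ¬ N c a → ¬ N c b → W c a b
  nbhd-walk (inj₁ refl) ca _  = here ca
  nbhd-walk (inj₂ e)    ca cb = step ca e (here cb)

  -- At its first vertex in N[d], the walk can turn off to `d`, which itself lies outside N[c].
  avoid-or-reach : ∀ {c d a b} → ¬ N c d → W c a b → W d a b ⊎ W c a d
  avoid-or-reach {d = d} cd p with N? d _
  avoid-or-reach cd p | yes da = inj₂ (nbhd-walk (N-sym da) (walk-start p) cd)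
  avoid-or-reach cd (here _) | no ¬da = inj₁ (here ¬da)
  avoid-or-reach cd (step ca e p) | no ¬da with avoid-or-reach cd p
  ... | inj₁ q = inj₁ (step ¬da e q)
  ... | inj₂ q = inj₂ (step ca e q)

  avoid : ∀ {c d a b} → ¬ N c d → ¬ W c a d → W c a b → W d a b
  avoid cd ¬r p = [ (λ q → q) , Empty-elim ∘ ¬r ]′ (avoid-or-reach cd p)

  between-swap : ∀ {x y z} → Between G x y z → Between G y x z
  between-swap = swap

  ¬between-self : ∀ {x z} → ¬ Between G x x z
  ¬between-self (p , _) = walk-end p N-refl

  between-separates : ATFree G → ∀ {x y z} → Between G x y z → ¬ W z x y
  between-separates at {x} {y} {z} (p , q) r = at z x y
    ( distinct q , distinct p , distinct (walk-sym p) , p , q , r )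
    where
    distinct : ∀ {c a b} → W c a b → a ≢ c
    distinct s refl = walk-start s N-refl

  -- Pairs (a , b) stand for the component of b in G − N[a].
  _≺_ : Rel (V × V) _
  (a , b) ≺ (c , d) = (∀ v → W a b v → W c d v) × ∃[ v ] W c d v × ¬ W a b v

  -- Strict inclusion is a strict partial order; `combine` codes the pairs in a finite set, where
  -- such orders are well-founded.
  ≺-wellFounded : WellFounded _≺_
  ≺-wellFounded =
    Subrelation.wellFounded
      (λ {i} {j} → subst₂ _≺_ (sym (remQuot-combine (proj₁ i) (proj₂ i)))
                              (sym (remQuot-combine (proj₁ j) (proj₂ j))))
      (On.wellFounded (uncurry combine) (spo-wellFounded {_⊏_ = _≺_ on remQuot n} (record
        { isEquivalence = isEquivalence
        ; irrefl = λ { refl (_ , _ , r , ¬r) → ¬r r }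
        ; trans = λ { (s , v , r , ¬r) (s′ , _) → (λ u → s′ u ∘ s u) , v , s′ v r , ¬r }
        ; <-resp-≈ = (λ { refl i → i }) , λ { refl i → i }
        })))

  -- `t` is the target left behind at a turn, `p` the current vertex, `y` its current target.
  Behind : V → V → V → Set
  Behind t p y = W t p y × ¬ W p y t × ¬ W y p t

  behind-refl : ∀ {t p y} → Behind t p y → W t p p
  behind-refl (tpy , _) = here (walk-start tpy)

  -- Arrows and chains relative to a convex set

  module _ (at : ATFree G) (Y : Subset n) (cY : Convex G Y) where

    _⟶_ : V → V → Set
    p ⟶ z = ∃[ y ] y ∈ Y × z ∉ Y × Between G p y z

    data Chain : ℕ → V → V → Set where
      [_] : ∀ {p q} → p ⟶ q → Chain zero p q
      _∷_ : ∀ {k p q r} → p ⟶ q → Chain k q r → Chain (suc k) p r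

    -- Moves a cycle on by one arrow. By the last component, an arrow from `p` straight to `w` would
    -- give a shorter cycle.
    rotate : ∀ {k z p r} → Chain k z p → p ⟶ r →
             ∃[ w ] z ⟶ w × Chain k w r × (∀ q → q ⟶ w → Chain k q p)
    rotate [ f ] e = _ , f , [ e ] , λ _ g → [ g ]
    rotate (f ∷ c) e with rotate c e
    ... | _ , f′ , c′ , _ = _ , f , f′ ∷ c′ , λ _ g → g ∷ c

    -- Two consecutive arrows

    module _ {p z w y y′ : V} (y∈Y : y ∈ Y) (y′∈Y : y′ ∈ Y) (z∉Y : z ∉ Y)
             (pyz : Between G p y z) (zy′w : Between G z y′ w) where

      private
        yzp = proj₁ pyz
        pzy = proj₂ pyz
        y′wz = proj₁ zy′w
        zwy′ = proj₂ zy′w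

        yz : ¬ N y z
        yz = walk-start yzp

        pz : ¬ N p z
        pz = walk-start pzy

        zp : ¬ N z p
        zp = pz ∘ N-sym

        zy : ¬ N z y
        zy = yz ∘ N-sym

        zy′ : ¬ N z y′
        zy′ = walk-end zwy′

        ¬zpy : ¬ W z p y
        ¬zpy = between-separates at pyz

        z-not-between : W y′ z y → ¬ W y z y′
        z-not-between r s = z∉Y (cY y y′ y∈Y y′∈Y z (r , s))

      behind-turn : W z p y′ → Behind y z y′
      behind-turn zpy′ = yzy′ , (λ r → ¬zpy (walk-trans zpy′ r)) , λ r → z-not-between r yzy′
        where
        yzy′ : W y z y′
        yzy′ = walk-trans yzp (avoid zy ¬zpy zpy′)

      -- The component of `z` off N[y] contains `p` but not `t`, so it avoids N[t]; `y` witnesses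
      -- strictness.
      turn-≺ : ∀ {t s} → Behind t p y → W t s p → (y , z) ≺ (t , s)
      turn-≺ {t} (tpy , ¬pyt , ¬ypt) tsp =
        (λ v yzv → walk-trans tsp (avoid yt ¬ypt (walk-trans (walk-sym yzp) yzv))) ,
        y , walk-trans tsp tpy , λ r → walk-end r N-refl
        where
        yt : ¬ N y t
        yt = walk-end tpy ∘ N-sym

      module _ (¬zpy′ : ¬ W z p y′) (¬py′w : ¬ Between G p y′ w) where

        private
          ¬zy′p : ¬ W z y′ p
          ¬zy′p = ¬zpy′ ∘ walk-sym

          forward-⊆ : ∀ {v} → W z y′ v → W p y′ v
          forward-⊆ = avoid zp ¬zy′p

          py′ : ¬ N p y′
          py′ = walk-start (forward-⊆ (walk-sym zwy′))

          y′p : ¬ N y′ p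
          y′p = py′ ∘ N-sym

          -- Otherwise `w` would be between `p` and `y′`, and the cycle could skip `z`.
          ¬y′zp : ¬ W y′ z p
          ¬y′zp r = ¬py′w (walk-trans y′wz r , walk-sym (forward-⊆ (walk-sym zwy′)))

        -- Unless `y′` is in N[y], the walks from `z` to `p` and to `y` either meet N[y′], and so
        -- can be diverted to `y′`, or avoid it. The only case not settled at once puts `z` between
        -- `y` and `y′`, against convexity.
        forward-component : ¬ ¬ W p y y′
        forward-component ¬pyy′ with N? y y′
        ... | yes yy′ = ¬pyy′ (walk-sym (forward-⊆ (walk-sym (nbhd-walk yy′ zy zy′))))
        ... | no ¬yy′ with avoid-or-reach ¬yy′ yzp
        ...   | inj₁ y′zp = ¬y′zp y′zp
        ...   | inj₂ yzy′ with avoid-or-reach py′ pzy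
        ...     | inj₁ y′zy = z-not-between y′zy yzy′
        ...     | inj₂ pzy′ = ¬pyy′ (walk-trans (walk-sym pzy) pzy′)

        forward-≺ : W p y y′ → (z , y′) ≺ (p , y)
        forward-≺ pyy′ =
          (λ v r → walk-trans pyy′ (forward-⊆ r)) , z , walk-sym pzy , λ r → walk-end r N-refl

        behind-forward : ∀ {t} → W p y y′ → Behind t p y → W t p z × Behind t z y′
        behind-forward {t} pyy′ (tpy , ¬pyt , ¬ypt) =
          tpz , (walk-trans (walk-sym tpz) (walk-trans tpy (avoid pt ¬pyt pyy′)) ,
                 (λ r → ¬pyt (walk-trans pyy′ (forward-⊆ r))) ,
                 -- The component of `z` off N[y′] misses `p`, so it avoids N[p] and lies in the
                 -- component of `y` there, which misses `t`.
                 λ r → ¬pyt (walk-trans (walk-sym pzy) (avoid y′p ¬y′zp r)))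
          where
          pt : ¬ N p t
          pt = walk-start tpy ∘ N-sym
          tpz : W t p z
          tpz = avoid (walk-end tpy ∘ N-sym) ¬ypt (walk-sym yzp)

    -- Excluding shortest cycles

    module _ {k : ℕ} (minimal : ∀ p → ¬ Chain k p p) where

      -- `Chain k` has k + 1 arrows, so this cycle has k + 2, and `minimal` forbids those with one
      -- arrow fewer.
      Cycle : V → V → V → Set
      Cycle p y z = y ∈ Y × z ∉ Y × Between G p y z × Chain k z p

      Turn Forward : V → V → V → V → Set
      Turn p y z y′ = Behind y z y′ × (∀ {t s} → Behind t p y → W t s p → (y , z) ≺ (t , s))
      Forward p y z y′ = (z , y′) ≺ (p , y) × (∀ {t} → Behind t p y → W t p z × Behind t z y′)

      next : ∀ {p y z} → Cycle p y z →
             ¬ ¬ (∃[ w ] ∃[ y′ ] Cycle z y′ w × (Turn p y z y′ ⊎ Forward p y z y′))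
      next {p} {y} {z} (y∈Y , z∉Y , pyz , c) none with rotate c (y , y∈Y , z∉Y , pyz)
      ... | w , (y′ , y′∈Y , w∉Y , zy′w) , c′ , shorten = ¬¬turn ¬turn
        where
        continue : ¬ (Turn p y z y′ ⊎ Forward p y z y′)
        continue r = none (w , y′ , (y′∈Y , w∉Y , zy′w , c′) , r)
        ¬turn : ¬ W z p y′
        ¬turn zpy′ = continue (inj₁
          (behind-turn y∈Y y′∈Y z∉Y pyz zy′w zpy′ , turn-≺ y∈Y y′∈Y z∉Y pyz zy′w))
        ¬py′w : ¬ Between G p y′ w
        ¬py′w py′w = minimal p (shorten p (y′ , y′∈Y , w∉Y , py′w))
        ¬¬turn : ¬ ¬ W z p y′
        ¬¬turn ¬zpy′ = forward-component y∈Y y′∈Y z∉Y pyz zy′w ¬zpy′ ¬py′w λ pyy′ →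
          continue (inj₂
            ( forward-≺ y∈Y y′∈Y z∉Y pyz zy′w ¬zpy′ ¬py′w pyy′
            , behind-forward y∈Y y′∈Y z∉Y pyz zy′w ¬zpy′ ¬py′w pyy′))

      -- Forward steps shrink the component of `y` off N[p], so a turn must come; `P` is the
      -- invariant carried up to it.
      no-cycle-until-turn : (P : V → V → Set) →
        (∀ {p y z y′} → Forward p y z y′ → P p y → P z y′) →
        (∀ {p y z y′ w} → Turn p y z y′ → P p y → ¬ Cycle z y′ w) →
        ∀ {p y} → Acc _≺_ (p , y) → P p y → ∀ {z} → ¬ Cycle p y z
      no-cycle-until-turn P keep turn (acc rs) Ppy c = next c λ
        { (_ , _ , c′ , inj₁ t) → turn t Ppy c′
        ; (_ , _ , c′ , inj₂ f) →
            no-cycle-until-turn P keep turn (rs (proj₁ f)) (keep f Ppy) c′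
        }

      -- The fixed `s` names the component of `p` off N[t], which forward steps preserve. Each turn
      -- shrinks it and restarts the inner induction.
      no-cycle-behind : ∀ {t s} → Acc _≺_ (t , s) →
        ∀ {p y z} → W t s p → Behind t p y → ¬ Cycle p y z
      no-cycle-behind {t} {s} (acc rs) tsp b = no-cycle-until-turn
        (λ p y → W t s p × Behind t p y)
        (λ (_ , stay) (tsp , b) → let tpz , b′ = stay b in walk-trans tsp tpz , b′)
        (λ (b′ , shrink) (tsp , b) → no-cycle-behind (rs (shrink b tsp)) (behind-refl b′) b′)
        (≺-wellFounded _) (tsp , b)

      no-cycle : ∀ {p y z} → ¬ Cycle p y z
      no-cycle = no-cycle-until-turn (λ _ _ → ⊤) _
        (λ (b , _) _ → no-cycle-behind (≺-wellFounded _) (behind-refl b) b)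
        (≺-wellFounded _) _

    acyclic : ∀ k p → ¬ Chain k p p
    acyclic zero p [ _ , _ , _ , _ , ppy ] = walk-start ppy N-refl
    acyclic (suc k) p ((_ , y∈Y , z∉Y , pyz) ∷ c) = no-cycle (acyclic k) (y∈Y , z∉Y , pyz , c)

    -- From acyclicity to one-point extensions

    _⟶⁺_ : V → V → Set
    p ⟶⁺ q = ∃[ k ] Chain k p q

    ⟶⁺-trans : ∀ {p q r} → p ⟶⁺ q → q ⟶⁺ r → p ⟶⁺ r
    ⟶⁺-trans (_ , [ e ])   (_ , d) = _ , e ∷ d
    ⟶⁺-trans (_ , e ∷ c) d with ⟶⁺-trans (_ , c) d
    ... | _ , cd = _ , e ∷ cd

    ⟵⁺-wellFounded : WellFounded (λ q p → p ⟶⁺ q)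
    ⟵⁺-wellFounded = spo-noetherian (record
      { isEquivalence = isEquivalence
      ; irrefl = λ { refl (k , c) → acyclic k _ c }
      ; trans = ⟶⁺-trans
      ; <-resp-≈ = (λ { refl e → e }) , λ { refl e → e }
      })

    extend-convex : ∀ {p} → (∀ y v → y ∈ Y → Between G p y v → v ∈ Y) →
                    Convex G (Y ∪ ⁅ p ⁆)
    extend-convex {p} sink u w u∈ w∈ v uwv
      with x∈p∪q⁻ Y ⁅ p ⁆ u∈ | x∈p∪q⁻ Y ⁅ p ⁆ w∈
    ... | inj₁ u∈Y | inj₁ w∈Y = p⊆p∪q ⁅ p ⁆ (cY u w u∈Y w∈Y v uwv)
    ... | inj₁ u∈Y | inj₂ w∈p rewrite x∈⁅y⁆⇒x≡y p w∈p =
      p⊆p∪q ⁅ p ⁆ (sink u v u∈Y (between-swap uwv))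
    ... | inj₂ u∈p | inj₁ w∈Y rewrite x∈⁅y⁆⇒x≡y p u∈p = p⊆p∪q ⁅ p ⁆ (sink w v w∈Y uwv)
    ... | inj₂ u∈p | inj₂ w∈p rewrite x∈⁅y⁆⇒x≡y p u∈p | x∈⁅y⁆⇒x≡y p w∈p =
      Empty-elim (¬between-self uwv)

    one-point-extension : ∀ {x} → x ∉ Y → ¬ ¬ (∃[ p ] p ∉ Y × Convex G (Y ∪ ⁅ p ⁆))
    one-point-extension x∉Y none = go (⟵⁺-wellFounded _) x∉Y
      where
      go : ∀ {p} → Acc (λ q p → p ⟶⁺ q) p → ¬ p ∉ Y
      go {p} (acc rs) p∉Y = none (p , p∉Y , extend-convex sink)
        where
        sink : ∀ y v → y ∈ Y → Between G p y v → v ∈ Y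
        sink y v y∈Y pyv with v ∈? Y
        ... | yes v∈Y = v∈Y
        ... | no v∉Y = Empty-elim (go (rs (zero , [ y , y∈Y , v∉Y , pyv ])) v∉Y)

-- From one-point extensions to anti-exchange

∪-monoˡ : ∀ {n} {A B : Subset n} (C : Subset n) → A ⊆ B → A ∪ C ⊆ B ∪ C
∪-monoˡ {A = A} C A⊆B = x∈p∪q⁺ ∘ [ inj₁ ∘ A⊆B , inj₂ ]′ ∘ x∈p∪q⁻ A C

InHull-mono : ∀ {n} {𝒞 : Subset n → Set} {A B : Subset n} {x} →
              A ⊆ B → InHull 𝒞 A x → InHull 𝒞 B x
InHull-mono A⊆B hull C cC B⊆C = hull C cC (B⊆C ∘ A⊆B)

∉-insert : ∀ {n} {Y : Subset n} {x z} → z ≢ x → z ∉ Y → z ∉ Y ∪ ⁅ x ⁆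
∉-insert {Y = Y} {x} z≢x z∉Y = [ z∉Y , z≢x ∘ x∈⁅y⁆⇒x≡y x ]′ ∘ x∈p∪q⁻ Y ⁅ x ⁆

insert-⊃ : ∀ {n} {Y : Subset n} {p} → p ∉ Y → (Y ∪ ⁅ p ⁆) ⊃ Y
insert-⊃ {Y = Y} {p} p∉Y = p⊆p∪q ⁅ p ⁆ , p , q⊆p∪q Y ⁅ p ⁆ (x∈⁅x⁆ p) , p∉Y

module _ {n : ℕ} (𝒞 : Subset n → Set)
         (extension : ∀ Y → 𝒞 Y → ∀ {x} → x ∉ Y → ¬ ¬ (∃[ p ] p ∉ Y × 𝒞 (Y ∪ ⁅ p ⁆)))
         where

  -- Add points to Y one at a time: the first set containing x or z contains only one of them.
  extension⇒antiExchange : ∀ Y → Acc _⊃_ Y → ∀ x z → x ≢ z → x ∉ Y → z ∉ Y →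
    InHull 𝒞 (Y ∪ ⁅ x ⁆) z → InHull 𝒞 (Y ∪ ⁅ z ⁆) x → ¬ 𝒞 Y
  extension⇒antiExchange Y (acc rs) x z x≢z x∉Y z∉Y zhull xhull cY =
    extension Y cY x∉Y absurd
    where
    absurd : ¬ (∃[ p ] p ∉ Y × 𝒞 (Y ∪ ⁅ p ⁆))
    absurd (p , p∉Y , cYp) with p ≟ x | p ≟ z
    ... | yes refl | _ = ∉-insert (x≢z ∘ sym) z∉Y (zhull _ cYp (λ i → i))
    ... | no _ | yes refl = ∉-insert x≢z x∉Y (xhull _ cYp (λ i → i))
    ... | no p≢x | no p≢z =
      extension⇒antiExchange (Y ∪ ⁅ p ⁆) (rs (insert-⊃ p∉Y)) x z x≢z
        (∉-insert (p≢x ∘ sym) x∉Y) (∉-insert (p≢z ∘ sym) z∉Y)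
        (InHull-mono (∪-monoˡ ⁅ x ⁆ (p⊆p∪q ⁅ p ⁆)) zhull)
        (InHull-mono (∪-monoˡ ⁅ z ⁆ (p⊆p∪q ⁅ p ⁆)) xhull) cYp

theorem2p6 : (n : ℕ) (G : Graph n) → ATFree G → ConvexGeometry (Convex G)
theorem2p6 n G at = record
  { full  = λ _ _ _ _ _ _ → ∈⊤
  ; empty = λ _ _ u∈⊥ → Empty-elim (∉⊥ u∈⊥)
  ; inter = λ A B cA cB u w u∈ w∈ z uwz →
      let u∈A , u∈B = x∈p∩q⁻ A B u∈
          w∈A , w∈B = x∈p∩q⁻ A B w∈
      in x∈p∩q⁺ (cA u w u∈A w∈A z uwz , cB u w u∈B w∈B z uwz)
  ; antiExchange = λ Y cY x z x≢z x∉Y z∉Y zhull xhull →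
      extension⇒antiExchange (Convex G) (one-point-extension G at) Y (⊃-wellFounded Y)
        x z x≢z x∉Y z∉Y zhull xhull cY
  }
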